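{- There exists a string family on which $\ell = \Omega(g_{rl}\log n/\log\log n)$. That is, there is an infinite set $\mathcal{F}$ of strings such that $\ell(w)=\Omega\big(g_{rl}(w)\log n/\log\log n\big)$ for $w\in\mathcal{F}$, where $n=|w|$.
   Context: A string family is an infinite set of finite strings of unbounded length; asymptotic notation on a family refers to strings $w$ of the family with $n=|w|\to\infty$ (with constants uniform over the family). $w[i:j]$ denotes the substring of $w$ from position $i$ to position $j$ (positions start at 1). L-systems: an L-system is a tuple $(\Sigma,\varphi,\tau,s,d,n)$, where $\Sigma$ is a finite alphabet, $\varphi:\Sigma^*\to\Sigma^*$ is a non-erasing monoid endomorphism (each rule $a\to\varphi(a)$, $a\in\Sigma$, has $|\varphi(a)|\ge 1$), $\tau:\Sigma^*\to\Sigma^*$ is a coding (a morphism with $|\tau(a)|=1$ for all $a\in\Sigma$), $s\in\Sigma^+$ is the axiom, and $d\ge 0$, $n\ge 1$ are integers. It generates the unique string $\tau(\varphi^d(s))[1:n]$ of length $n$. It is always assumed that $d=n^{O(1)}$ and $|\Sigma|=n^{O(1)}$ (each value fits in an $O(\log n)$-bit word). The size of the L-system is $\sum_{a\in\Sigma}|\varphi(a)|+|s|+|\Sigma|+2$. The measure $\ell(w)$ is the size of the smallest L-system generating $w$. Run-length grammars: a straight-line program (SLP) is a deterministic context-free grammar whose language is a single string $\{w\}$; its size is the sum of the lengths of the right-hand sides of its rules. A run-length SLP (RLSLP) additionally allows rules of the form $A\to a^m$ with $m>1$ ($a$ a grammar symbol), each counted as having constant size. $g_{rl}(w)$ is the size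 of the smallest RLSLP generating $w$. -}

module Defs where

open import Data.Fin.Base using (Fin)
open import Data.List.Base
  using (List; []; _∷_; [_]; _++_; length; map; take; concatMap; replicate; sum; tabulate)
open import Data.List.NonEmpty.Base as List⁺ using (List⁺)
open import Data.Nat.Base using (ℕ; _+_; _*_; _^_; _≤_; _<_)
open import Data.Nat.GeneralisedArithmetic using (fold)
open import Data.Nat.Logarithm using (⌊log₂_⌋)
open import Data.Product.Base using (_×_; ∃-syntax)
open import Function.Base using (_∘_)
open import Function.Bundles using (_⇔_; _↣_; module Injection)
open import Level using (0ℓ)
open import Relation.Binary.PropositionalEquality using (_≡_)
open import Relation.Unary using (Pred; _∈_)

-- All symbols are drawn from one countably infinite supply, so that strings
-- over different finite alphabets can be compared and auxiliary symbols are
-- always available.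
String : Set
String = List ℕ

-- Unbounded length already makes the set infinite.
IsFamily : Pred String 0ℓ → Set
IsFamily F = ∀ N → ∃[ w ] w ∈ F × N ≤ length w

IsLeast : Pred ℕ 0ℓ → Pred ℕ 0ℓ
IsLeast P m = m ∈ P × (∀ k → k ∈ P → m ≤ k)

-- The alphabet Σ is the image of the injection `symbol`.  The morphisms φ and τ
-- are given by their values on letters; `List⁺` makes φ non-erasing and the
-- axiom non-empty.
record LSystem : Set where
  field
    σ      : ℕ
    symbol : Fin σ ↣ ℕ
    φ      : Fin σ → List⁺ (Fin σ)
    τ      : Fin σ → Fin σ
    s      : List⁺ (Fin σ)
    d      : ℕ
    n      : ℕ
    n≥1    : 1 ≤ n

  φ* : List (Fin σ) → List (Fin σ)
  φ* = concatMap (List⁺.toList ∘ φ)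

  φ^d[s] : List (Fin σ)
  φ^d[s] = fold (List⁺.toList s) φ* d

  size : ℕ
  size = sum (tabulate (List⁺.length ∘ φ)) + List⁺.length s + σ + 2

  -- `take` truncates silently, so the length is required separately.
  Generates : Pred String 0ℓ
  Generates w =
    length w ≡ n × w ≡ map (Injection.to symbol) (take n (map τ φ^d[s]))

-- The standing assumption d = n^O(1), |Σ| = n^O(1), with the exponent c
-- explicit.
PolyBounded : ℕ → Pred LSystem 0ℓ
PolyBounded c L = d ≤ n ^ c × σ ≤ n ^ c
  where open LSystem L

-- m = ℓ(w), the minimum being over the L-systems satisfying the standing
-- assumption with exponent c.
Isℓ : ℕ → String → Pred ℕ 0ℓ
Isℓ c w = IsLeast λ k →
  ∃[ L ] PolyBounded c L × LSystem.Generates L w × LSystem.size L ≡ k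

data Symbol (v : ℕ) : Set where
  terminal    : ℕ → Symbol v
  nonterminal : Fin v → Symbol v

data RHS (v : ℕ) : Set where
  seq : List (Symbol v) → RHS v
  run : Symbol v → (m : ℕ) → 1 < m → RHS v

module _ {v : ℕ} where

  expand : RHS v → List (Symbol v)
  expand (seq α)     = α
  expand (run X m _) = replicate m X

  -- A run X^m is stored as the pair (X , m); any other positive constant changes
  -- the smallest size only by a constant factor.
  rhsSize : RHS v → ℕ
  rhsSize (seq α)     = length α
  rhsSize (run _ _ _) = 2

-- Determinism is the fact that `rule` is a function.  Acyclicity is not imposed
-- here: on the variables that matter it follows from the language being a
-- singleton.
record RLGrammar : Set where
  field
    v     : ℕ
    rule  : Fin v → RHS v
    start : Fin v

  infix 4 _⇓_ _⇓*_

  mutual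
    data _⇓_ : Symbol v → String → Set where
      terminal    : ∀ {a} → terminal a ⇓ [ a ]
      nonterminal : ∀ {A u} → expand (rule A) ⇓* u → nonterminal A ⇓ u

    data _⇓*_ : List (Symbol v) → String → Set where
      []  : [] ⇓* []
      _∷_ : ∀ {X α u u′} → X ⇓ u → α ⇓* u′ → X ∷ α ⇓* u ++ u′

  Language : Pred String 0ℓ
  Language u = nonterminal start ⇓ u

  Generates : Pred String 0ℓ
  Generates w = ∀ u → u ∈ Language ⇔ u ≡ w

  size : ℕ
  size = sum (tabulate (rhsSize ∘ rule))

Isgᵣₗ : String → Pred ℕ 0ℓ
Isgᵣₗ w = IsLeast λ k →
  ∃[ G ] RLGrammar.Generates G w × RLGrammar.size G ≡ k

-- log log n, up to rounding: ⌊log₂ ⌊log₂ n⌋⌋ = ⌊log₂ (log₂ n)⌋.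
loglog : ℕ → ℕ
loglog n = ⌊log₂ ⌊log₂ n ⌋ ⌋

{-# OPTIONS --safe #-}
module Submission where

-- A counting argument.  Take r = 2^q, p = 2r, B = 2^p and the B^p words
--   0^(2+x₁) 1^(1+B−x₁) ⋯ 0^(2+x_p) 1^(1+B−x_p),   0 ≤ xᵢ < B,
-- all of the same length n = p (3 + B).  An L-system of size at most S with d < D that
-- generates a binary word of length n can be stored in d and a table of S triples
-- (tag, letter, letter), so there are at most D (4 (S+2)²)^S words with such a system.
-- For D = 2^(2r²) and S ≈ r² / (6 (q+1)) this is less than B^p = 2^(4r²), hence some word
-- needs an L-system of size Ω(p² / log p), whereas g_rl = O(p), log n = Θ(p) and
-- log log n = Θ(log p).  Since n^c = 2^O(cp) is eventually below D, one family serves all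
-- exponents c.

open import Defs
open import Data.Fin.Base
  using (Fin; zero; suc; toℕ; fromℕ<; inject≤; opposite; combine; remQuot; finToFun; funToFin)
open import Data.Fin.Patterns using (0F; 1F; 2F)
import Data.Fin.Properties as Fin
open import Data.List.Base
  using (List; []; _∷_; [_]; _++_; length; map; take; concat; concatMap; replicate; tabulate; lookup; filter)
open import Data.List.NonEmpty.Base as List⁺ using ()
import Data.List.Properties as List
open import Data.List.Relation.Unary.All as All using (All; []; _∷_)
import Data.List.Relation.Unary.All.Properties as All
open import Data.Nat.Base
open import Data.Nat.DivMod using (_/_; /-monoˡ-≤; m*n/n≡m; m/n≤m; m/n*n≤m)
open import Data.Nat.GeneralisedArithmetic using (fold)
open import Data.Nat.ListAction using (sum)
open import Data.Nat.Logarithm using (⌊log₂_⌋; ⌊log₂⌋-mono-≤; ⌊log₂[2^n]⌋≡n)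
open import Data.Nat.Properties
open import Data.Nat.Tactic.RingSolver using (solve-∀)
open import Data.Product.Base using (_×_; _,_; proj₁; proj₂; Σ-syntax; ∃-syntax; map₁)
import Data.Product.Properties as Product
open import Function.Base using (_∘_; id)
open import Function.Bundles using (Injection; mk⇔)
open import Function.Definitions using (Injective)
open import Level using (0ℓ)
open import Relation.Binary.PropositionalEquality
  using (_≡_; _≢_; _≗_; refl; sym; trans; cong; cong₂; subst; module ≡-Reasoning)
open import Relation.Nullary using (¬_; yes; no; contradiction)
open import Relation.Unary using (Pred; _∈_)

-- Run-length grammars linear in the number of runs.

-- A pair (a , m) stands for the run a^(m+2), as the exponent of a run rule exceeds 1.
unrun : List (ℕ × ℕ) → String
unrun = concatMap λ (a , m) → replicate (2 + m) a

module Denotation (G : RLGrammar) (val : Fin (RLGrammar.v G) → String) where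

  open RLGrammar G

  denote : Symbol v → String
  denote (terminal a)    = [ a ]
  denote (nonterminal A) = val A

  ⇓*-denote : ∀ {α} → All (λ X → X ⇓ denote X) α → α ⇓* concatMap denote α
  ⇓*-denote []       = []
  ⇓*-denote (p ∷ ps) = p ∷ ⇓*-denote ps

  module _ (val-rule : ∀ A → concatMap denote (expand (rule A)) ≡ val A) where

    -- A cyclic grammar may satisfy `val-rule` and derive nothing, so derivations of the right-hand
    -- side have to be supplied.
    ⇓-nonterminal : ∀ A → All (λ X → X ⇓ denote X) (expand (rule A)) → nonterminal A ⇓ val A
    ⇓-nonterminal A ps = subst (nonterminal A ⇓_) (val-rule A) (nonterminal (⇓*-denote ps))

    mutual
      -- By induction on the derivation, any `val` compatible with all rules determines every
      -- derivable string; acyclicity does not enter.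
      ⇓-unique : ∀ {X u} → X ⇓ u → u ≡ denote X
      ⇓-unique terminal                = refl
      ⇓-unique (nonterminal {A = A} p) = trans (⇓*-unique p) (val-rule A)

      ⇓*-unique : ∀ {α u} → α ⇓* u → u ≡ concatMap denote α
      ⇓*-unique []       = refl
      ⇓*-unique (p ∷ ps) = cong₂ _++_ (⇓-unique p) (⇓*-unique ps)

module _ (rs : List (ℕ × ℕ)) where

  private
    block : Fin (length rs) → Symbol (suc (length rs))
    block j = nonterminal (suc j)

  -- Each run costs 3: one symbol in the start rule and 2 for a rule of its own.
  runGrammar : RLGrammar
  runGrammar = record
    { v     = suc (length rs)
    ; rule  = λ where
        zero    → seq (tabulate (block))
        (suc j) → run (terminal (proj₁ (lookup rs j))) (2 + proj₂ (lookup rs j)) (s≤s (s≤s z≤n))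
    ; start = zero
    }

  open RLGrammar runGrammar

  private
    val : Fin v → String
    val zero    = unrun rs
    val (suc j) = replicate (2 + proj₂ (lookup rs j)) (proj₁ (lookup rs j))

    open Denotation runGrammar val

    concatMap-terminal : ∀ a m → concatMap denote (replicate m (terminal a)) ≡ replicate m a
    concatMap-terminal a zero    = refl
    concatMap-terminal a (suc m) = cong (a ∷_) (concatMap-terminal a m)

    val-rule : ∀ A → concatMap denote (expand (rule A)) ≡ val A
    val-rule zero = cong concat (begin
      map denote (tabulate (block))  ≡⟨ List.map-tabulate (block) denote ⟩
      tabulate (val ∘ suc)                       ≡⟨ List.map-tabulate (lookup rs) _ ⟨
      map _ (tabulate (lookup rs))               ≡⟨ cong (map _) (List.tabulate-lookup rs) ⟩
      map _ rs                                   ∎)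
      where open ≡-Reasoning
    val-rule (suc j) = concatMap-terminal (proj₁ (lookup rs j)) (2 + proj₂ (lookup rs j))

    derive-suc : ∀ j → nonterminal (suc j) ⇓ val (suc j)
    derive-suc j = ⇓-nonterminal val-rule (suc j) (All.replicate⁺ (2 + proj₂ (lookup rs j)) terminal)

    derive-start : nonterminal zero ⇓ unrun rs
    derive-start = ⇓-nonterminal val-rule zero (All.tabulate⁺ derive-suc)

  runGrammar-generates : Generates (unrun rs)
  runGrammar-generates u = mk⇔ (⇓-unique val-rule) (λ { refl → derive-start })

  runGrammar-size : size ≡ 3 * length rs
  runGrammar-size = cong₂ _+_ (List.length-tabulate {n = length rs} (block))
                              (trans (sum-twos (length rs)) (*-comm (length rs) 2))
    where
    sum-twos : ∀ n → sum (tabulate {n = n} (λ _ → 2)) ≡ n * 2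
    sum-twos zero    = refl
    sum-twos (suc n) = cong (2 +_) (sum-twos n)

-- Binary words of equal length encoding digit strings.

module _ {B : ℕ} where

  -- The complementary exponent `opposite x` makes every digit contribute `3 + B` letters, so the
  -- length of the word reveals only the number of digits.
  blocks : List (Fin B) → List (ℕ × ℕ)
  blocks = concatMap λ x → (0 , toℕ x) ∷ (1 , toℕ (opposite x)) ∷ []

  word : List (Fin B) → String
  word = unrun ∘ blocks

  length-blocks : ∀ xs → length (blocks xs) ≡ 2 * length xs
  length-blocks []       = refl
  length-blocks (x ∷ xs) = begin
    2 + length (blocks xs)  ≡⟨ cong (2 +_) (length-blocks xs) ⟩
    2 + 2 * length xs       ≡⟨ *-suc 2 (length xs) ⟨
    2 * suc (length xs)     ∎
    where open ≡-Reasoning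

  toℕ+opposite : ∀ (x : Fin B) → suc (toℕ x) + toℕ (opposite x) ≡ B
  toℕ+opposite x =
    trans (cong (suc (toℕ x) +_) (Fin.opposite-prop x)) (m+[n∸m]≡n (Fin.toℕ<n x))

  length-word : ∀ xs → length (word xs) ≡ length xs * (3 + B)
  length-word []       = refl
  length-word (x ∷ xs) = begin
    length (replicate (2 + m) 0 ++ replicate (2 + o) 1 ++ word xs)
      ≡⟨ List.length-++ (replicate (2 + m) 0) ⟩
    length (replicate (2 + m) 0) + length (replicate (2 + o) 1 ++ word xs)
      ≡⟨ cong₂ _+_ (List.length-replicate (2 + m)) (List.length-++ (replicate (2 + o) 1)) ⟩
    2 + m + (length (replicate (2 + o) 1) + length (word xs))
      ≡⟨ cong₂ (λ a b → 2 + m + (a + b)) (List.length-replicate (2 + o)) (length-word xs) ⟩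
    2 + m + (2 + o + length xs * (3 + B))
      ≡⟨ regroup m o (length xs * (3 + B)) ⟩
    3 + (suc m + o) + length xs * (3 + B)
      ≡⟨ cong (λ b → 3 + b + length xs * (3 + B)) (toℕ+opposite x) ⟩
    3 + B + length xs * (3 + B) ∎
    where
    open ≡-Reasoning
    m = toℕ x
    o = toℕ (opposite x)
    regroup : ∀ m o l → 2 + m + (2 + o + l) ≡ 3 + (suc m + o) + l
    regroup = solve-∀

  word-binary : ∀ xs → All (_≤ 1) (word xs)
  word-binary []       = []
  word-binary (x ∷ xs) =
    All.++⁺ (All.replicate⁺ (2 + toℕ x) z≤n)
      (All.++⁺ (All.replicate⁺ (2 + toℕ (opposite x)) ≤-refl) (word-binary xs))

  -- The first `1` marks the end of the zeros; if only one side starts with `1`, the heads already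
  -- differ.
  zeros-injective : ∀ m n {u v : String} →
    replicate m 0 ++ 1 ∷ u ≡ replicate n 0 ++ 1 ∷ v → m ≡ n
  zeros-injective zero    zero    eq = refl
  zeros-injective (suc m) (suc n) eq = cong suc (zeros-injective m n (List.∷-injectiveʳ eq))

  word-injective : ∀ xs ys → length xs ≡ length ys → word xs ≡ word ys → xs ≡ ys
  word-injective []       []       len eq = refl
  word-injective (x ∷ xs) (y ∷ ys) len eq
    -- The run of ones is never empty, so `eq` has a `1` right after the zeros. This recovers the
    -- first digit, and the two runs it fixes are then cancelled.
    with refl ← Fin.toℕ-injective
      (+-cancelˡ-≡ 2 _ _ (zeros-injective (2 + toℕ x) (2 + toℕ y) eq))
    = cong (x ∷_) (word-injective xs ys (suc-injective len)
        (List.++-cancelˡ (replicate (2 + toℕ (opposite x)) 1) _ _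
          (List.++-cancelˡ (replicate (2 + toℕ x) 0) _ _ eq)))

-- Enumeration of digit strings and the pigeonhole principle.

digits : ∀ {B p} → Fin (B ^ p) → List (Fin B)
digits {B} {p} i = tabulate (finToFun {B} {p} i)

tabulate-injective : ∀ {A : Set} {n} {f g : Fin n → A} → tabulate f ≡ tabulate g → f ≗ g
tabulate-injective eq zero    = List.∷-injectiveˡ eq
tabulate-injective eq (suc i) = tabulate-injective (List.∷-injectiveʳ eq) i

-- Takes the place of function extensionality in `digits-injective`: equal tabulations give only
-- pointwise equality.
funToFin-cong : ∀ {m n} {f g : Fin m → Fin n} → f ≗ g → funToFin f ≡ funToFin g
funToFin-cong {zero}  eq = refl
funToFin-cong {suc m} eq = cong₂ combine (eq zero) (funToFin-cong (eq ∘ suc))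

digits-injective : ∀ {B p} → Injective _≡_ _≡_ (digits {B} {p})
digits-injective {B} {p} {i} {j} eq = begin
  i                                 ≡⟨ Fin.funToFin-finToFin {p} i ⟨
  funToFin (finToFun {B} {p} i)     ≡⟨ funToFin-cong (tabulate-injective eq) ⟩
  funToFin (finToFun {B} {p} j)     ≡⟨ Fin.funToFin-finToFin {p} j ⟩
  j                                 ∎
  where open ≡-Reasoning

length-digits : ∀ {B p} (i : Fin (B ^ p)) → length (digits {B} {p} i) ≡ p
length-digits {B} {p} i = List.length-tabulate (finToFun {B} {p} i)

-- If `g` hit every `f i`, choosing preimages would inject `Fin a` into the smaller `Fin b`. String
-- equality is decidable and both index sets are finite, so the missed index is found
-- constructively.
avoid : ∀ {a b} → b < a → (f : Fin a → String) → Injective _≡_ _≡_ f → (g : Fin b → String) →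
  ∃[ i ] ∀ j → g j ≢ f i
avoid {a} b<a f f-inj g =
  let i , avoids = Fin.¬∀⟶∃¬ a _ (λ i → Fin.any? λ j → List.≡-dec _≟_ (g j) (f i)) ¬all
  in i , λ j eq → avoids (j , eq)
  where
  ¬all : ¬ (∀ i → ∃[ j ] g j ≡ f i)
  ¬all hit =
    let i , i′ , i<i′ , eq = Fin.pigeonhole b<a (proj₁ ∘ hit)
        same = trans (sym (proj₂ (hit i))) (trans (cong g eq) (proj₂ (hit i′)))
    in Fin.<⇒≢ i<i′ (f-inj same)

untabulate : ∀ {A : Set} {n} (xs : List A) → length xs ≡ n → ∃[ f ] tabulate {n = n} f ≡ xs
untabulate xs refl = lookup xs , List.tabulate-lookup xs

-- Encoding L-systems as tables of fixed length.

module Code (S : ℕ) where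

  -- An alphabet of size at most `S` fits; the 2 extra letters guarantee that `0F` and `1F` exist
  -- even when `S` is 0.
  Letter : Set
  Letter = Fin (2 + S)

  Key : Set
  Key = Fin 4 × Letter

  -- A list stored under a key takes one entry per letter, in table order. Rules of varying length
  -- thus cost exactly their length, as in the size of an L-system.
  Table : Set
  Table = List (Key × Letter)

  -- Letters other than the chosen ones are irrelevant under tag 0, and tag 3 never occurs in
  -- a table that encodes an L-system.
  axiom pad : Key
  axiom = 0F , 0F
  pad   = 0F , 1F

  rule out : Letter → Key
  rule a = 1F , a
  out  a = 2F , a

  infix 9 _!_
  _!_ : Table → Key → List Letter
  T ! k = map proj₂ (filter (λ e → Product.≡-dec Fin._≟_ Fin._≟_ (proj₁ e) k) T)

  -- Every table is given a meaning, well formed or not, so that decoding is total.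
  execute : Table → (d n : ℕ) → String
  execute T d n =
    take n (concatMap (λ a → map toℕ (T ! out a)) (fold (T ! axiom) (concatMap (λ a → T ! rule a)) d))

  !-++ : ∀ T T′ k → (T ++ T′) ! k ≡ T ! k ++ T′ ! k
  !-++ T T′ k = trans (cong (map proj₂) (List.filter-++ _ T T′)) (List.map-++ proj₂ (filter _ T) _)

  !-hit : ∀ k xs → map (k ,_) xs ! k ≡ xs
  !-hit k xs = begin
    map proj₂ (filter _ (map (k ,_) xs))  ≡⟨ cong (map proj₂) (List.filter-all _ (All.map⁺ (All.universal (λ _ → refl) xs))) ⟩
    map proj₂ (map (k ,_) xs)             ≡⟨ List.map-∘ xs ⟨
    map id xs                             ≡⟨ List.map-id xs ⟩
    xs                                    ∎
    where open ≡-Reasoning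

  !-miss : ∀ {k k′} → k ≢ k′ → ∀ xs → map (k ,_) xs ! k′ ≡ []
  !-miss k≢k′ xs = cong (map proj₂) (List.filter-none _ (All.map⁺ (All.universal (λ _ → k≢k′) xs)))

  entries : ∀ {σ} → (Fin σ → Key) → (Fin σ → List Letter) → Table
  entries key f = concat (tabulate λ a → map (key a ,_) (f a))

  !-entries-miss : ∀ {σ} (key : Fin σ → Key) f {k} → (∀ a → key a ≢ k) → entries key f ! k ≡ []
  !-entries-miss {zero}  key f     key≢k = refl
  !-entries-miss {suc σ} key f {k} key≢k = trans (!-++ (map (key zero ,_) (f zero)) _ k)
    (cong₂ _++_ (!-miss (key≢k zero) (f zero)) (!-entries-miss (key ∘ suc) (f ∘ suc) (key≢k ∘ suc)))

  -- Since keys are distinct, lookup filters all other segments to the empty list.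
  !-entries-hit : ∀ {σ} (key : Fin σ → Key) f → Injective _≡_ _≡_ key →
    ∀ a → entries key f ! key a ≡ f a
  !-entries-hit {suc σ} key f inj zero = begin
    entries key f ! key zero          ≡⟨ !-++ (map (key zero ,_) (f zero)) _ _ ⟩
    map (key zero ,_) (f zero) ! key zero ++ entries (key ∘ suc) (f ∘ suc) ! key zero
      ≡⟨ cong₂ _++_ (!-hit (key zero) (f zero))
           (!-entries-miss (key ∘ suc) (f ∘ suc) (λ a eq → contradiction (inj eq) λ ())) ⟩
    f zero ++ []                      ≡⟨ List.++-identityʳ (f zero) ⟩
    f zero                            ∎
    where open ≡-Reasoning
  !-entries-hit {suc σ} key f inj (suc a) = begin
    entries key f ! key (suc a)       ≡⟨ !-++ (map (key zero ,_) (f zero)) _ _ ⟩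
    map (key zero ,_) (f zero) ! key (suc a) ++ entries (key ∘ suc) (f ∘ suc) ! key (suc a)
      ≡⟨ cong₂ _++_ (!-miss (λ eq → contradiction (inj eq) λ ()) (f zero))
           (!-entries-hit (key ∘ suc) (f ∘ suc) (Fin.suc-injective ∘ inj) a) ⟩
    f (suc a)                         ∎
    where open ≡-Reasoning

  length-entries : ∀ {σ} (key : Fin σ → Key) f → length (entries key f) ≡ sum (tabulate (length ∘ f))
  length-entries {zero}  key f = refl
  length-entries {suc σ} key f = trans (List.length-++ (map (key zero ,_) (f zero)))
    (cong₂ _+_ (List.length-map _ (f zero)) (length-entries (key ∘ suc) (f ∘ suc)))

  entryCount : ℕ
  entryCount = 4 * (2 + S) * (2 + S)

  -- The depth may far exceed the size, so it is coded outside the table, as one of `D` values. The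
  -- length `n` is an argument of `decode` and is not coded.
  codeCount : ℕ → ℕ
  codeCount D = D * entryCount ^ S

  entry : Fin entryCount → Key × Letter
  entry e = map₁ (remQuot (2 + S)) (remQuot {4 * (2 + S)} (2 + S) e)

  decode : ∀ {D} → ℕ → Fin (codeCount D) → String
  decode {D} n c = let d , f = remQuot {D} _ c in
    execute (tabulate (entry ∘ finToFun {n = S} f)) (toℕ d) n

  decode-surjective : ∀ {D} T d n → length T ≡ S → d < D → ∃[ c ] decode {D} n c ≡ execute T d n
  decode-surjective {D} T d n |T|≡S d<D = combine (fromℕ< d<D) (funToFin f) , (begin
    decode {D} n (combine (fromℕ< d<D) (funToFin f))
      ≡⟨ cong (λ (d , f) → execute (tabulate (entry ∘ finToFun {n = S} f)) (toℕ d) n)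
              (Fin.remQuot-combine (fromℕ< d<D) (funToFin f)) ⟩
    execute (tabulate (entry ∘ finToFun {n = S} (funToFin f))) (toℕ (fromℕ< d<D)) n
      ≡⟨ cong₂ (λ T d → execute T d n) (trans (List.tabulate-cong entry-f) (proj₂ row))
               (Fin.toℕ-fromℕ< d<D) ⟩
    execute T d n ∎)
    where
    open ≡-Reasoning
    unentry : Key × Letter → Fin entryCount
    unentry ((t , a) , b) = combine (combine t a) b
    row : ∃[ g ] tabulate {n = S} g ≡ T
    row = untabulate T |T|≡S
    f : Fin S → Fin entryCount
    f = unentry ∘ proj₁ row
    entry-unentry : ∀ e → entry (unentry e) ≡ e
    entry-unentry ((t , a) , b) = trans
      (cong (map₁ (remQuot (2 + S))) (Fin.remQuot-combine {n = 4 * (2 + S)} (combine t a) b))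
      (cong (_, b) (Fin.remQuot-combine t a))
    entry-f : entry ∘ finToFun {n = S} (funToFin f) ≗ proj₁ row
    entry-f i = trans (cong entry (Fin.finToFun-funToFin f i)) (entry-unentry (proj₁ row i))

  module _ (L : LSystem) (size≤S : LSystem.size L ≤ S) where

    open LSystem L using (σ; symbol; φ; τ; s; d; n; φ*; φ^d[s])

    private
      sym-τ : Fin σ → ℕ
      sym-τ = Injection.to symbol ∘ τ

      σ≤ : σ ≤ 2 + S
      σ≤ = ≤-trans (≤-trans (m≤n+m σ _) (m≤m+n _ 2)) (≤-trans size≤S (m≤n+m S 2))

      ι : Fin σ → Letter
      ι a = inject≤ a σ≤

      -- `symbol` takes arbitrarily large values, but truncating them at 1 does not change a
      -- binary generated string.
      clamp : ℕ → Letter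
      clamp x = fromℕ< (≤-trans (s≤s (m⊓n≤n x 1)) (s≤s (s≤s z≤n)))

      -- The core has as many entries as the size of `L` minus 2. Padding under a key that `execute`
      -- never reads brings every table to length exactly `S`, so one count covers all sizes up to
      -- `S`.
      Tₛ Tφ Tτ core table : Table
      Tₛ = map (axiom ,_) (map ι (List⁺.toList s))
      Tφ = entries (rule ∘ ι) (map ι ∘ List⁺.toList ∘ φ)
      Tτ = entries (out ∘ ι) ([_] ∘ clamp ∘ sym-τ)
      core = Tₛ ++ Tφ ++ Tτ
      table = core ++ map (pad ,_) (replicate (S ∸ length core) 0F)

      length-core : length core ≤ S
      length-core = ≤-trans (≤-reflexive (begin
        length core ≡⟨ List.length-++ Tₛ ⟩
        length Tₛ + length (Tφ ++ Tτ) ≡⟨ cong (length Tₛ +_) (List.length-++ Tφ) ⟩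
        length Tₛ + (length Tφ + length Tτ)
          ≡⟨ cong₂ _+_ (trans (List.length-map (axiom ,_) (map ι (List⁺.toList s))) (List.length-map ι (List⁺.toList s)))
              (cong₂ _+_ (trans (length-entries (rule ∘ ι) (map ι ∘ List⁺.toList ∘ φ)) (cong sum (List.tabulate-cong λ a → List.length-map ι (List⁺.toList (φ a)))))
                         (trans (length-entries (out ∘ ι) ([_] ∘ clamp ∘ sym-τ)) (sum-ones σ))) ⟩
        List⁺.length s + (sum (tabulate (List⁺.length ∘ φ)) + σ) ≡⟨ regroup (List⁺.length s) _ σ ⟩
        sum (tabulate (List⁺.length ∘ φ)) + List⁺.length s + σ ∎))
        (≤-trans (m≤m+n _ 2) size≤S)
        where
        open ≡-Reasoning
        regroup : ∀ a b c → a + (b + c) ≡ b + a + c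
        regroup = solve-∀
        sum-ones : ∀ n → sum (tabulate {n = n} (λ _ → 1)) ≡ n
        sum-ones zero    = refl
        sum-ones (suc n) = cong suc (sum-ones n)

      length-table : length table ≡ S
      length-table = begin
        length table ≡⟨ List.length-++ core ⟩
        length core + length (map (pad ,_) (replicate (S ∸ length core) 0F))
          ≡⟨ cong (length core +_) (trans (List.length-map _ (replicate (S ∸ length core) 0F)) (List.length-replicate _)) ⟩
        length core + (S ∸ length core) ≡⟨ m+[n∸m]≡n length-core ⟩
        S ∎
        where open ≡-Reasoning

      table-! : ∀ k → pad ≢ k → table ! k ≡ Tₛ ! k ++ Tφ ! k ++ Tτ ! k
      table-! k pad≢k = begin
        table ! k ≡⟨ !-++ core _ k ⟩
        core ! k ++ map (pad ,_) (replicate (S ∸ length core) 0F) ! k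
          ≡⟨ cong (core ! k ++_) (!-miss pad≢k (replicate (S ∸ length core) 0F)) ⟩
        core ! k ++ [] ≡⟨ List.++-identityʳ _ ⟩
        core ! k ≡⟨ !-++ Tₛ _ k ⟩
        Tₛ ! k ++ (Tφ ++ Tτ) ! k ≡⟨ cong (Tₛ ! k ++_) (!-++ Tφ Tτ k) ⟩
        Tₛ ! k ++ Tφ ! k ++ Tτ ! k ∎
        where open ≡-Reasoning

      ι-injective : ∀ {a b} → ι a ≡ ι b → a ≡ b
      ι-injective = Fin.inject≤-injective σ≤ σ≤ _ _

      missₛ : ∀ {k} → axiom ≢ k → Tₛ ! k ≡ []
      missₛ axiom≢k = !-miss axiom≢k (map ι (List⁺.toList s))

      missφ : ∀ {k} → (∀ a → rule (ι a) ≢ k) → Tφ ! k ≡ []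
      missφ = !-entries-miss (rule ∘ ι) (map ι ∘ List⁺.toList ∘ φ)

      missτ : ∀ {k} → (∀ a → out (ι a) ≢ k) → Tτ ! k ≡ []
      missτ = !-entries-miss (out ∘ ι) ([_] ∘ clamp ∘ sym-τ)

      table-axiom : table ! axiom ≡ map ι (List⁺.toList s)
      table-axiom = trans (table-! axiom λ ()) (trans
        (cong₂ _++_ (!-hit axiom (map ι (List⁺.toList s))) (cong₂ _++_ (missφ {axiom} λ _ ()) (missτ {axiom} λ _ ())))
        (List.++-identityʳ _))

      table-rule : ∀ a → table ! rule (ι a) ≡ map ι (List⁺.toList (φ a))
      table-rule a = trans (table-! (rule (ι a)) λ ()) (trans
        (cong₂ _++_ (missₛ {rule (ι a)} λ ()) (cong₂ _++_
          (!-entries-hit (rule ∘ ι) (map ι ∘ List⁺.toList ∘ φ) (ι-injective ∘ Product.,-injectiveʳ) a)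
          (missτ {rule (ι a)} λ _ ())))
        (List.++-identityʳ _))

      table-out : ∀ a → table ! out (ι a) ≡ [ clamp (sym-τ a) ]
      table-out a = trans (table-! (out (ι a)) λ ())
        (cong₂ _++_ (missₛ {out (ι a)} λ ()) (cong₂ _++_
          (missφ {out (ι a)} λ _ ())
          (!-entries-hit (out ∘ ι) ([_] ∘ clamp ∘ sym-τ) (ι-injective ∘ Product.,-injectiveʳ) a)))

      table-φ* : ∀ xs → concatMap (λ a → table ! rule a) (map ι xs) ≡ map ι (φ* xs)
      table-φ* xs = begin
        concatMap (λ a → table ! rule a) (map ι xs)   ≡⟨ List.concatMap-map (λ a → table ! rule a) ι xs ⟩
        concatMap (λ a → table ! rule (ι a)) xs       ≡⟨ List.concatMap-cong table-rule xs ⟩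
        concatMap (map ι ∘ List⁺.toList ∘ φ) xs       ≡⟨ List.map-concatMap ι (List⁺.toList ∘ φ) xs ⟨
        map ι (φ* xs)                                 ∎
        where open ≡-Reasoning

      -- The renaming `ι` commutes with one rewriting step by `table-φ*`, hence with `d` of them.
      table-fold : ∀ d → fold (table ! axiom) (concatMap (λ a → table ! rule a)) d
                       ≡ map ι (fold (List⁺.toList s) φ* d)
      table-fold zero    = table-axiom
      table-fold (suc d) = trans (cong (concatMap λ a → table ! rule a) (table-fold d)) (table-φ* (fold (List⁺.toList s) φ* d))

      table-τ : ∀ xs → concatMap (λ a → map toℕ (table ! out a)) (map ι xs) ≡ map (λ a → sym-τ a ⊓ 1) xs
      table-τ xs = begin
        concatMap (λ a → map toℕ (table ! out a)) (map ι xs)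
          ≡⟨ List.concatMap-map (λ a → map toℕ (table ! out a)) ι xs ⟩
        concatMap (λ a → map toℕ (table ! out (ι a))) xs
          ≡⟨ List.concatMap-cong (λ a → trans (cong (map toℕ) (table-out a)) (cong [_] (Fin.toℕ-fromℕ< _))) xs ⟩
        concatMap (λ a → [ sym-τ a ⊓ 1 ]) xs
          ≡⟨ List.concatMap-map [_] (λ a → sym-τ a ⊓ 1) xs ⟨
        concatMap [_] (map (λ a → sym-τ a ⊓ 1) xs)
          ≡⟨ List.concatMap-pure _ ⟩
        map (λ a → sym-τ a ⊓ 1) xs ∎
        where open ≡-Reasoning

    -- The table outputs letters clamped at 1. Clamping acts letter by letter, so it commutes with
    -- truncation, and it fixes the binary word `w`.
    execute-table : ∀ {w} → All (_≤ 1) w → LSystem.Generates L w → execute table d (length w) ≡ w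
    execute-table {w} w≤1 (len , gen) = begin
      execute table d (length w)
        ≡⟨ cong (take (length w) ∘ concatMap (λ a → map toℕ (table ! out a))) (table-fold d) ⟩
      take (length w) (concatMap (λ a → map toℕ (table ! out a)) (map ι φ^d[s]))
        ≡⟨ cong₂ take len (table-τ φ^d[s]) ⟩
      take n (map (λ a → sym-τ a ⊓ 1) φ^d[s])                     ≡⟨ cong (take n) (List.map-∘ φ^d[s]) ⟩
      take n (map (λ b → Injection.to symbol b ⊓ 1) (map τ φ^d[s])) ≡⟨ List.take-map n _ ⟩
      map (λ b → Injection.to symbol b ⊓ 1) (take n (map τ φ^d[s])) ≡⟨ List.map-∘ _ ⟩
      map (_⊓ 1) (map (Injection.to symbol) (take n (map τ φ^d[s]))) ≡⟨ cong (map (_⊓ 1)) gen ⟨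
      map (_⊓ 1) w                                                ≡⟨ List.map-id-local (All.map m≤n⇒m⊓n≡m w≤1) ⟩
      w ∎
      where open ≡-Reasoning

    code-complete : ∀ {D w} → d < D → All (_≤ 1) w → LSystem.Generates L w →
      ∃[ c ] decode {D} (length w) c ≡ w
    code-complete {w = w} d<D w≤1 gen =
      let c , eq = decode-surjective table d (length w) length-table d<D
      in c , trans eq (execute-table w≤1 gen)

-- With fewer codes than digit strings, some word is not decoded from any code, whereas a small
-- L-system generating it would supply one.
incompressible : ∀ {B p S D} → Code.codeCount S D < B ^ p →
  Σ[ xs ∈ List (Fin B) ] length xs ≡ p ×
    (∀ L → LSystem.size L ≤ S → LSystem.d L < D → ¬ LSystem.Generates L (word xs))
incompressible {B} {p} {S} {D} codes<words = digits {B} {p} i , length-digits {B} {p} i ,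
  λ L size≤S d<D gen →
    let c , eq = Code.code-complete S L size≤S d<D (word-binary (digits {B} {p} i)) gen
    -- The decoder is run at the common length `p * (3 + B)`, fixed before the word is chosen;
    -- `subst` moves to it from the length of this word.
    in avoids c (subst (λ n → Code.decode S {D} n c ≡ word (digits {B} {p} i)) (length-word-digits i) eq)
  where
  length-word-digits : ∀ i → length (word (digits {B} {p} i)) ≡ p * (3 + B)
  length-word-digits i =
    trans (length-word (digits {B} {p} i)) (cong (_* (3 + B)) (length-digits {B} {p} i))

  word-digits-injective : Injective _≡_ _≡_ (word ∘ digits {B} {p})
  word-digits-injective {i} {j} = digits-injective ∘ word-injective (digits {B} {p} i) (digits {B} {p} j)
    (trans (length-digits {B} {p} i) (sym (length-digits {B} {p} j)))

  avoided : ∃[ i ] ∀ c → Code.decode S {D} (p * (3 + B)) c ≢ word (digits {B} {p} i)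
  avoided = avoid codes<words (word ∘ digits {B} {p}) word-digits-injective (Code.decode S {D} (p * (3 + B)))

  i : Fin (B ^ p)
  i = proj₁ avoided

  avoids : ∀ c → Code.decode S {D} (p * (3 + B)) c ≢ word (digits {B} {p} i)
  avoids = proj₂ avoided

-- Choice of parameters and numerical estimates.

n<2^n : ∀ n → n < 2 ^ n
n<2^n zero    = s≤s z≤n
n<2^n (suc n) =
  subst (suc n <_) (cong (2 ^ n +_) (sym (+-identityʳ (2 ^ n)))) (+-mono-≤-< (m^n>0 2 n) (n<2^n n))

module Parameters (q : ℕ) where

  -- A budget in bits: the words need `p * p`, which is `4 * (r * r)`. The depth takes
  -- `2 * (r * r)`, and `S` entries of `6 * t` bits take at most `r * r`, which leaves a spare
  -- `r * r`.
  t r p B D S : ℕ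
  t = suc q
  r = 2 ^ q
  p = 2 ^ t
  B = 2 ^ p
  D = 2 ^ (2 * (r * r))
  S = r * r / (6 * t)

  open ≤-Reasoning

  collect : ∀ a → a + (2 * a + a) ≡ 4 * a
  collect = solve-∀

  1≤p : 1 ≤ p
  1≤p = m^n>0 2 t

  1≤r² : 1 ≤ r * r
  1≤r² = *-mono-≤ (m^n>0 2 q) (m^n>0 2 q)

  p²≡4r² : p * p ≡ 4 * (r * r)
  p²≡4r² = square r
    where
    square : ∀ r → 2 * r * (2 * r) ≡ 4 * (r * r)
    square = solve-∀

  letters≤ : 2 + S ≤ p * p
  letters≤ = begin
    2 + S                  ≤⟨ +-mono-≤ (*-monoʳ-≤ 2 1≤r²) (m/n≤m (r * r) (6 * t)) ⟩
    2 * (r * r) + r * r    ≤⟨ m≤n+m _ (r * r) ⟩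
    r * r + (2 * (r * r) + r * r) ≡⟨ collect (r * r) ⟩
    4 * (r * r)            ≡⟨ p²≡4r² ⟨
    p * p                  ∎

  -- Each of the three factors is at most `p * p`, that is `2 * t` bits; hence the divisor `6 * t`
  -- in `S`.
  entries≤ : Code.entryCount S ≤ 2 ^ (t * 6)
  entries≤ = begin
    4 * (2 + S) * (2 + S)        ≤⟨ *-mono-≤ (*-mono-≤ 4≤p² letters≤) letters≤ ⟩
    (p * p) * (p * p) * (p * p)  ≡⟨ sixth p ⟩
    p ^ 6                        ≡⟨ ^-*-assoc 2 t 6 ⟩
    2 ^ (t * 6)                  ∎
    where
    4≤p² : 4 ≤ p * p
    4≤p² = *-mono-≤ (*-monoʳ-≤ 2 (m^n>0 2 q)) (*-monoʳ-≤ 2 (m^n>0 2 q))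
    sixth : ∀ p → (p * p) * (p * p) * (p * p) ≡ p * (p * (p * (p * (p * (p * 1)))))
    sixth = solve-∀

  codes<words : Code.codeCount S D < B ^ p
  codes<words = begin-strict
    D * Code.entryCount S ^ S        ≤⟨ *-monoʳ-≤ D (^-monoˡ-≤ S entries≤) ⟩
    D * (2 ^ (t * 6)) ^ S            ≡⟨ cong (D *_) (^-*-assoc 2 (t * 6) S) ⟩
    D * 2 ^ (t * 6 * S)              ≡⟨ ^-distribˡ-+-* 2 (2 * (r * r)) (t * 6 * S) ⟨
    2 ^ (2 * (r * r) + t * 6 * S)    <⟨ ^-monoʳ-< 2 (s≤s (s≤s z≤n)) exponent ⟩
    2 ^ (p * p)                      ≡⟨ ^-*-assoc 2 p p ⟨
    B ^ p                            ∎
    where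
    exponent : 2 * (r * r) + t * 6 * S < p * p
    exponent = begin-strict
      2 * (r * r) + t * 6 * S  ≡⟨ cong (2 * (r * r) +_) (trans (*-comm (t * 6) S) (cong (S *_) (*-comm t 6))) ⟩
      2 * (r * r) + S * (6 * t) ≤⟨ +-monoʳ-≤ (2 * (r * r)) (m/n*n≤m (r * r) (6 * t)) ⟩
      -- Strictness comes from the spare `r * r`, which is at least 1.
      2 * (r * r) + r * r      <⟨ +-monoˡ-≤ (2 * (r * r) + r * r) 1≤r² ⟩
      r * r + (2 * (r * r) + r * r) ≡⟨ collect (r * r) ⟩
      4 * (r * r)              ≡⟨ p²≡4r² ⟨
      p * p                    ∎

  length-lower : 2 ^ p ≤ p * (3 + B)
  length-lower = ≤-trans (m≤n+m B 3) (m≤n*m (3 + B) p {{>-nonZero 1≤p}})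

  -- A crude bound suffices for `log n` to be O(p): `p` is at most `B`, `3 + B` at most `4 * B`, and
  -- 2 at most `2 * p`.
  length-upper : p * (3 + B) ≤ 2 ^ (4 * p)
  length-upper = begin
    p * (3 + B)            ≤⟨ *-mono-≤ (<⇒≤ (n<2^n p)) (+-monoˡ-≤ B (*-monoʳ-≤ 3 (m^n>0 2 p))) ⟩
    B * (3 * B + B)        ≡⟨ cong (B *_) (+-comm (3 * B) B) ⟩
    B * (2 ^ 2 * B)        ≡⟨ cong (B *_) (^-distribˡ-+-* 2 2 p) ⟨
    B * 2 ^ (2 + p)        ≡⟨ ^-distribˡ-+-* 2 p (2 + p) ⟨
    2 ^ (p + (2 + p))      ≤⟨ ^-monoʳ-≤ 2 (+-monoʳ-≤ p (+-monoˡ-≤ p (*-monoʳ-≤ 2 1≤p))) ⟩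
    2 ^ (p + (2 * p + p))  ≡⟨ cong (2 ^_) (collect p) ⟩
    2 ^ (4 * p)            ∎

  |word| : ∀ (xs : List (Fin B)) → length xs ≡ p → length (word xs) ≡ p * (3 + B)
  |word| xs |xs| = trans (length-word xs) (cong (_* (3 + B)) |xs|)

  -- Multiplying out avoids the rounding in `S`. The depth is bounded by `D` instead of a power of
  -- `n`, which keeps the notion independent of `c`.
  Hard : String → Set
  Hard w = ∀ L → LSystem.d L < D → LSystem.Generates L w → r * r ≤ 6 * t * LSystem.size L

  hard-word : Σ[ xs ∈ List (Fin B) ] length xs ≡ p × Hard (word xs)
  hard-word = let xs , |xs| , ¬gen = incompressible codes<words in xs , |xs| , hard ¬gen
    where
    hard : ∀ {w} → (∀ L → LSystem.size L ≤ S → LSystem.d L < D → ¬ LSystem.Generates L w) → Hard w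
    hard ¬gen L d<D gen with r * r ≤? 6 * t * LSystem.size L
    ... | yes r²≤ = r²≤
    ... | no  r²≰ = contradiction gen (¬gen L size≤S d<D)
      where
      -- Failure of the bound gives `6 * t * size ≤ r * r`, and integer division by `6 * t` is
      -- monotone.
      size≤S : LSystem.size L ≤ S
      size≤S = begin
        LSystem.size L                      ≡⟨ m*n/n≡m (LSystem.size L) (6 * t) ⟨
        LSystem.size L * (6 * t) / (6 * t)  ≤⟨ /-monoˡ-≤ (6 * t) (≤-trans
          (≤-reflexive (*-comm (LSystem.size L) (6 * t))) (<⇒≤ (≰⇒> r²≰))) ⟩
        S                                   ∎

-- The family and the asymptotic comparison.

HardWords : Pred String 0ℓ
HardWords w = ∃[ q ] Σ[ xs ∈ List (Fin (B q)) ] length xs ≡ p q × w ≡ word xs × Hard q w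
  where open Parameters

hardWords-unbounded : IsFamily HardWords
hardWords-unbounded N = word xs , (N , xs , |xs| , refl , hard) , (begin
    N                    ≤⟨ <⇒≤ (n<2^n N) ⟩
    r                    ≤⟨ m≤n*m r 2 ⟩
    p                    ≤⟨ <⇒≤ (n<2^n p) ⟩
    2 ^ p                ≤⟨ length-lower ⟩
    p * (3 + B)          ≡⟨ |word| xs |xs| ⟨
    length (word xs)     ∎)
  where
  open Parameters N
  open ≤-Reasoning
  xs : List (Fin B)
  xs = proj₁ hard-word
  |xs| : length xs ≡ p
  |xs| = proj₁ (proj₂ hard-word)
  hard : Hard (word xs)
  hard = proj₂ (proj₂ hard-word)

lemma2 : Σ[ F ∈ Pred String 0ℓ ]
    IsFamily F ×
    (∀ (c : ℕ) → ∃[ K ] ∃[ N ]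
    (∀ w → w ∈ F → N ≤ length w →
    ∀ ℓ g → ℓ ∈ Isℓ c w → g ∈ Isgᵣₗ w →
    g * ⌊log₂ length w ⌋ ≤ K * (ℓ * loglog (length w))))
-- The constant 576 is 96 times 6: `6 * p` bounds `g`, `4 * p` bounds the logarithm, their product
-- is `96 * (r * r)`, and hardness contributes `6 * t`. The threshold exceeds every length possible
-- with `q ≤ 4 * c`.
lemma2 = HardWords , hardWords-unbounded , λ c → 576 , suc (2 ^ (4 * 2 ^ suc (4 * c))) , bound c
  where
  bound : ∀ c w → w ∈ HardWords → suc (2 ^ (4 * 2 ^ suc (4 * c))) ≤ length w →
    ∀ ℓ g → ℓ ∈ Isℓ c w → g ∈ Isgᵣₗ w → g * ⌊log₂ length w ⌋ ≤ 576 * (ℓ * loglog (length w))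
  -- For `ℓ`, the L-system attaining the minimum is taken and `ℓ` becomes its size; for `g`,
  -- minimality is applied to `runGrammar`.
  bound c w (q , xs , |xs| , refl , hard) N≤n ℓ g ((L , (d≤ , _) , gen , refl) , _) (_ , g-least) = begin
    g * ⌊log₂ n ⌋                ≤⟨ *-mono-≤ g≤ log≤ ⟩
    (3 * (2 * p)) * (4 * p)      ≡⟨ rescale r ⟩
    96 * (r * r)                 ≤⟨ *-monoʳ-≤ 96 (hard L d<D gen) ⟩
    96 * (6 * t * size)          ≡⟨ regroup t size ⟩
    576 * (size * t)             ≤⟨ *-monoʳ-≤ 576 (*-monoʳ-≤ size t≤loglog) ⟩
    576 * (size * loglog n)      ∎
    where
    open ≤-Reasoning
    open Parameters q
    open LSystem L using (d; size)

    n : ℕ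
    n = length (word xs)

    |w| : n ≡ p * (3 + B)
    |w| = |word| xs |xs|

    n≤ : n ≤ 2 ^ (4 * p)
    n≤ = ≤-trans (≤-reflexive |w|) length-upper

    rescale : ∀ r → (3 * (2 * (2 * r))) * (4 * (2 * r)) ≡ 96 * (r * r)
    rescale = solve-∀

    regroup : ∀ t s → 96 * (6 * t * s) ≡ 576 * (s * t)
    regroup = solve-∀

    g≤ : g ≤ 3 * (2 * p)
    g≤ = begin
      g                                         ≤⟨ g-least _ (runGrammar (blocks xs) , runGrammar-generates (blocks xs) , refl) ⟩
      RLGrammar.size (runGrammar (blocks xs))   ≡⟨ runGrammar-size (blocks xs) ⟩
      3 * length (blocks xs)                    ≡⟨ cong (3 *_) (length-blocks xs) ⟩
      3 * (2 * length xs)                       ≡⟨ cong (λ l → 3 * (2 * l)) |xs| ⟩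
      3 * (2 * p)                               ∎

    log≤ : ⌊log₂ n ⌋ ≤ 4 * p
    log≤ = ≤-trans (⌊log₂⌋-mono-≤ n≤) (≤-reflexive (⌊log₂[2^n]⌋≡n (4 * p)))

    t≤loglog : t ≤ loglog n
    t≤loglog = begin
      t                        ≡⟨ ⌊log₂[2^n]⌋≡n t ⟨
      ⌊log₂ p ⌋                ≡⟨ cong ⌊log₂_⌋ (⌊log₂[2^n]⌋≡n p) ⟨
      ⌊log₂ ⌊log₂ 2 ^ p ⌋ ⌋    ≤⟨ ⌊log₂⌋-mono-≤ (⌊log₂⌋-mono-≤ (≤-trans length-lower (≤-reflexive (sym |w|)))) ⟩
      loglog n                 ∎

    4c<r : 4 * c < r
    4c<r with q ≤? 4 * c
    ... | no  q≰4c = <-trans (≰⇒> q≰4c) (n<2^n q)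
    -- A small `q` would keep `n` below the threshold, by `n≤`.
    ... | yes q≤4c = contradiction N≤n (≤⇒≯ (≤-trans n≤
      (^-monoʳ-≤ 2 (*-monoʳ-≤ 4 (^-monoʳ-≤ 2 (s≤s q≤4c))))))

    -- As `p` is `2 * r`, the exponent `4 * p * c` equals `2 * (r * (4 * c))`, and `4 * c < r` puts
    -- it below the exponent of `D`.
    d<D : d < D
    d<D = begin-strict
      d                      ≤⟨ d≤ ⟩
      LSystem.n L ^ c        ≡⟨ cong (_^ c) (proj₁ gen) ⟨
      n ^ c                  ≤⟨ ^-monoˡ-≤ c n≤ ⟩
      (2 ^ (4 * p)) ^ c      ≡⟨ ^-*-assoc 2 (4 * p) c ⟩
      2 ^ (4 * p * c)        ≡⟨ cong (2 ^_) (exponent r c) ⟩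
      2 ^ (2 * (r * (4 * c))) <⟨ ^-monoʳ-< 2 (s≤s (s≤s z≤n)) (*-monoʳ-< 2 (*-monoʳ-< r {{m^n≢0 2 q}} 4c<r)) ⟩
      D                      ∎
      where
      exponent : ∀ r c → 4 * (2 * r) * c ≡ 2 * (r * (4 * c))
      exponent = solve-∀
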